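{- Let $n\ge 3$, let $c_{ij}$ ($1\le i,j\le n$) be real costs with $c_{ii}=0$ for all $i$ and $c_{ij}\ge 0$ for all $i\ne j$, let $\varepsilon>0$, and let $c_{\max}:=\max_{1\le i,j\le n}c_{ij}+\varepsilon$. For $x\in[0,1]^{n\times n}$ define $$\rho_i(x):=\sum_{j=1}^n x_{ij}-1,\qquad \kappa_j(x):=\sum_{i=1}^n x_{ij}-1,$$ $$V_{\mathrm{deg}}(x):=\sum_{i=1}^n\rho_i(x)^2+\sum_{j=1}^n\kappa_j(x)^2-2\sum_{i=1}^n\sum_{j=1}^n x_{ij}^2+2\sum_{i=1}^n\sum_{j=1}^n x_{ij},$$ $$\hat f_{\mathrm{deg}}(x):=\sum_{i=1}^n\sum_{j=1}^n c_{ij}x_{ij}+\varepsilon\sum_{i=1}^n\sum_{j=1}^n x_{ij}+\gamma V_{\mathrm{deg}}(x).$$ Assume $\gamma>c_{\max}$. Then every local minimizer $x^\star$ of $\hat f_{\mathrm{deg}}$ over $[0,1]^{n\times n}$ satisfies $$\sum_{j=1}^n x^\star_{ij}=1\ \ \forall i,\qquad \sum_{i=1}^n x^\star_{ij}=1\ \ \forall j,$$ and hence is feasible for the assignment problem $$\min_x\ \sum_{i,j}c_{ij}x_{ij}\quad\text{s.t.}\quad \sum_{j}x_{ij}=1\ \forall i,\quad \sum_i x_{ij}=1\ \forall j,\quad x_{ij}\in\{0,1\}$$ (in particular $x^\star\in\{0,1\}^{n\times n}$).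
   Context: A local minimizer over $[0,1]^{n\times n}$ is a point of the box minimizing $\hat f_{\mathrm{deg}}$ among all points of the box in some neighborhood of it. -}

module Defs where

open import Algebra.Bundles.Raw using (RawMonoid)
import Algebra.Definitions.RawMonoid as Sum
open import Data.Fin.Base using (Fin; zero; suc)
open import Data.Nat.Base as ℕ using (ℕ; zero; suc; s≤s; z≤n)
import Data.Nat.Properties as ℕ
open import Data.Product.Base using (Σ-syntax; ∃-syntax; _×_; _,_)
open import Data.Rational.Base as ℚ using (ℚ; 0ℚ; 1ℚ; ½)
import Data.Rational.Properties as ℚ
open import Data.Rational.Solver using (module +-*-Solver)
open import Data.Sum.Base using (_⊎_; inj₁; inj₂)
open import Data.Vec.Functional using (Vector)
open import Level using (0ℓ)
open import Relation.Binary.PropositionalEquality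
  using (_≡_; refl; sym; trans; cong; cong₂; subst)
open import Relation.Nullary.Negation.Core using (¬_)

------------------------------------------------------------------------
-- Rational estimates

private
  open ℚ.≤-Reasoning
  open +-*-Solver

  halves : ∀ ε → ε ℚ.* ½ ℚ.+ ε ℚ.* ½ ≡ ε
  halves ε = trans (sym (ℚ.*-distribˡ-+ ε ½ ½)) (ℚ.*-identityʳ ε)

  half-pos : ∀ {ε} → 0ℚ ℚ.< ε → 0ℚ ℚ.< ε ℚ.* ½
  half-pos {ε} 0<ε = subst (ℚ._< ε ℚ.* ½) (ℚ.*-zeroˡ ½) (ℚ.*-monoˡ-<-pos ½ 0<ε)

  ∣∣-bound : ∀ p {r} → p ℚ.< r → ℚ.- p ℚ.< r → ℚ.∣ p ∣ ℚ.< r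
  ∣∣-bound p p<r -p<r with ℚ.∣p∣≡p∨∣p∣≡-p p
  ... | inj₁ eq = subst (ℚ._< _) (sym eq) p<r
  ... | inj₂ eq = subst (ℚ._< _) (sym eq) -p<r

  p≤∣p∣ : ∀ p → p ℚ.≤ ℚ.∣ p ∣
  p≤∣p∣ p with ℚ.≤-total 0ℚ p
  ... | inj₁ 0≤p = ℚ.≤-reflexive (sym (ℚ.0≤p⇒∣p∣≡p 0≤p))
  ... | inj₂ p≤0 = ℚ.≤-trans p≤0 (ℚ.0≤∣p∣ p)

  swap-sub : ∀ p q → ℚ.- (p ℚ.- q) ≡ q ℚ.- p
  swap-sub = solve 2 (λ p q → :- (p :- q) := q :- p) refl

  ∣∣-swap : ∀ p q → ℚ.∣ p ℚ.- q ∣ ≡ ℚ.∣ q ℚ.- p ∣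
  ∣∣-swap p q = trans (sym (ℚ.∣-p∣≡∣p∣ (p ℚ.- q))) (cong ℚ.∣_∣ (swap-sub p q))

  ⊔-dist : ∀ p q r s {ε} → ℚ.∣ p ℚ.- r ∣ ℚ.< ε → ℚ.∣ q ℚ.- s ∣ ℚ.< ε →
           (p ℚ.⊔ q) ℚ.- (r ℚ.⊔ s) ℚ.< ε
  ⊔-dist p q r s {ε} pr qs with ℚ.⊔-sel p q
  ... | inj₁ eq rewrite eq = begin-strict
    p ℚ.- (r ℚ.⊔ s) ≤⟨ ℚ.+-monoʳ-≤ p (ℚ.neg-antimono-≤ (ℚ.p≤p⊔q r s)) ⟩
    p ℚ.- r         ≤⟨ p≤∣p∣ (p ℚ.- r) ⟩
    ℚ.∣ p ℚ.- r ∣   <⟨ pr ⟩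
    ε               ∎
  ... | inj₂ eq rewrite eq = begin-strict
    q ℚ.- (r ℚ.⊔ s) ≤⟨ ℚ.+-monoʳ-≤ q (ℚ.neg-antimono-≤ (ℚ.p≤q⊔p r s)) ⟩
    q ℚ.- s         ≤⟨ p≤∣p∣ (q ℚ.- s) ⟩
    ℚ.∣ q ℚ.- s ∣   <⟨ qs ⟩
    ε               ∎

------------------------------------------------------------------------
-- The real numbers, as Cauchy sequences of rationals modulo _≃_.
--
-- The existential quantifiers below are Σ-types, so a real number comes with a
-- modulus of convergence.

IsCauchy : (ℕ → ℚ) → Set
IsCauchy x = ∀ ε → 0ℚ ℚ.< ε →
  ∃[ N ] (∀ m n → N ℕ.≤ m → N ℕ.≤ n → ℚ.∣ x m ℚ.- x n ∣ ℚ.< ε)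

record ℝ : Set where
  constructor mkℝ
  field
    seq    : ℕ → ℚ
    cauchy : IsCauchy seq

open ℝ public

infix 4 _≃_ _<_ _≤_

_≃_ : ℝ → ℝ → Set
x ≃ y = ∀ ε → 0ℚ ℚ.< ε →
  ∃[ N ] (∀ n → N ℕ.≤ n → ℚ.∣ seq x n ℚ.- seq y n ∣ ℚ.< ε)

_<_ : ℝ → ℝ → Set
x < y = Σ[ ε ∈ ℚ ] 0ℚ ℚ.< ε ×
  (∃[ N ] (∀ n → N ℕ.≤ n → seq x n ℚ.+ ε ℚ.< seq y n))

_≤_ : ℝ → ℝ → Set
x ≤ y = ¬ (y < x)

private
  common : ∀ {N₁ N₂ m} → N₁ ℕ.⊔ N₂ ℕ.≤ m → N₁ ℕ.≤ m × N₂ ℕ.≤ m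
  common {N₁} {N₂} N≤m =
    ℕ.≤-trans (ℕ.m≤m⊔n N₁ N₂) N≤m , ℕ.≤-trans (ℕ.m≤n⊔m N₁ N₂) N≤m

  eventually-bounded : ∀ {x} → IsCauchy x →
    Σ[ B ∈ ℚ ] 0ℚ ℚ.< B × (∃[ N ] (∀ n → N ℕ.≤ n → ℚ.∣ x n ∣ ℚ.≤ B))
  eventually-bounded {x} cx with cx 1ℚ (ℚ.positive⁻¹ 1ℚ)
  ... | N , close = B , 0<B , N , bound
    where
    B = 1ℚ ℚ.+ ℚ.∣ x N ∣
    0<B : 0ℚ ℚ.< B
    0<B = ℚ.+-mono-<-≤ (ℚ.positive⁻¹ 1ℚ) (ℚ.0≤∣p∣ (x N))
    split : ∀ p q → p ≡ (p ℚ.- q) ℚ.+ q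
    split = solve 2 (λ p q → p := (p :- q) :+ q) refl
    bound : ∀ n → N ℕ.≤ n → ℚ.∣ x n ∣ ℚ.≤ B
    bound n N≤n = begin
      ℚ.∣ x n ∣                        ≡⟨ cong ℚ.∣_∣ (split (x n) (x N)) ⟩
      ℚ.∣ (x n ℚ.- x N) ℚ.+ x N ∣      ≤⟨ ℚ.∣p+q∣≤∣p∣+∣q∣ (x n ℚ.- x N) (x N) ⟩
      ℚ.∣ x n ℚ.- x N ∣ ℚ.+ ℚ.∣ x N ∣  ≤⟨ ℚ.+-monoˡ-≤ ℚ.∣ x N ∣ (ℚ.<⇒≤ (close n N N≤n ℕ.≤-refl)) ⟩
      B                                ∎

  divide : ∀ {C ε} → 0ℚ ℚ.< C → 0ℚ ℚ.< ε → Σ[ δ ∈ ℚ ] 0ℚ ℚ.< δ × C ℚ.* δ ≡ ε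
  divide {C} {ε} 0<C 0<ε = C⁻¹ ℚ.* ε , 0<δ , Cδ≡ε
    where
    instance
      C-pos : ℚ.Positive C
      C-pos = ℚ.positive 0<C
      C-nonZero : ℚ.NonZero C
      C-nonZero = ℚ.pos⇒nonZero C
    C⁻¹ = ℚ.1/ C
    0<δ : 0ℚ ℚ.< C⁻¹ ℚ.* ε
    0<δ = subst (ℚ._< C⁻¹ ℚ.* ε) (ℚ.*-zeroʳ C⁻¹)
      (ℚ.*-monoʳ-<-pos C⁻¹ {{ℚ.1/pos⇒pos C}} 0<ε)
    Cδ≡ε : C ℚ.* (C⁻¹ ℚ.* ε) ≡ ε
    Cδ≡ε = trans (sym (ℚ.*-assoc C C⁻¹ ε))
      (trans (cong (ℚ._* ε) (ℚ.*-inverseʳ C)) (ℚ.*-identityˡ ε))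

  ∣∣*-bound : ∀ {p q D δ} → 0ℚ ℚ.< D → ℚ.∣ p ∣ ℚ.≤ D → ℚ.∣ q ∣ ℚ.< δ →
              ℚ.∣ p ℚ.* q ∣ ℚ.< D ℚ.* δ
  ∣∣*-bound {p} {q} {D} {δ} 0<D p≤D q<δ = begin-strict
    ℚ.∣ p ℚ.* q ∣         ≡⟨ ℚ.∣p*q∣≡∣p∣*∣q∣ p q ⟩
    ℚ.∣ p ∣ ℚ.* ℚ.∣ q ∣   ≤⟨ ℚ.*-monoʳ-≤-nonNeg ℚ.∣ q ∣ {{ℚ.∣-∣-nonNeg q}} p≤D ⟩
    D ℚ.* ℚ.∣ q ∣         <⟨ ℚ.*-monoʳ-<-pos D {{ℚ.positive 0<D}} q<δ ⟩
    D ℚ.* δ               ∎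

  *-dist : ∀ p q r s {A B δ} → 0ℚ ℚ.< A → 0ℚ ℚ.< B →
           ℚ.∣ p ∣ ℚ.≤ A → ℚ.∣ s ∣ ℚ.≤ B →
           ℚ.∣ p ℚ.- r ∣ ℚ.< δ → ℚ.∣ q ℚ.- s ∣ ℚ.< δ →
           ℚ.∣ p ℚ.* q ℚ.- r ℚ.* s ∣ ℚ.< (A ℚ.+ B) ℚ.* δ
  *-dist p q r s {A} {B} {δ} 0<A 0<B p≤A s≤B pr qs = begin-strict
    ℚ.∣ p ℚ.* q ℚ.- r ℚ.* s ∣
      ≡⟨ cong ℚ.∣_∣ (regroup p q r s) ⟩
    ℚ.∣ p ℚ.* (q ℚ.- s) ℚ.+ s ℚ.* (p ℚ.- r) ∣
      ≤⟨ ℚ.∣p+q∣≤∣p∣+∣q∣ (p ℚ.* (q ℚ.- s)) (s ℚ.* (p ℚ.- r)) ⟩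
    ℚ.∣ p ℚ.* (q ℚ.- s) ∣ ℚ.+ ℚ.∣ s ℚ.* (p ℚ.- r) ∣
      <⟨ ℚ.+-mono-< (∣∣*-bound {p} {q ℚ.- s} 0<A p≤A qs)
                    (∣∣*-bound {s} {p ℚ.- r} 0<B s≤B pr) ⟩
    A ℚ.* δ ℚ.+ B ℚ.* δ
      ≡⟨ ℚ.*-distribʳ-+ δ A B ⟨
    (A ℚ.+ B) ℚ.* δ ∎
    where
    regroup : ∀ p q r s →
      p ℚ.* q ℚ.- r ℚ.* s ≡ p ℚ.* (q ℚ.- s) ℚ.+ s ℚ.* (p ℚ.- r)
    regroup = solve 4
      (λ p q r s → p :* q :- r :* s := p :* (q :- s) :+ s :* (p :- r)) refl

  -- Abstract so that comparing real numbers never unfolds these proofs.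
  abstract
    const-cauchy : ∀ q → IsCauchy (λ _ → q)
    const-cauchy q ε 0<ε = 0 , λ _ _ _ _ →
      subst (ℚ._< ε) (cong ℚ.∣_∣ (sym (ℚ.+-inverseʳ q))) 0<ε

    neg-cauchy : ∀ {x} → IsCauchy x → IsCauchy (λ n → ℚ.- x n)
    neg-cauchy {x} cx ε 0<ε with cx ε 0<ε
    ... | N , close = N , λ m n N≤m N≤n →
      subst (ℚ._< ε) (sym (eq (x m) (x n))) (close m n N≤m N≤n)
      where
      eq : ∀ p q → ℚ.∣ (ℚ.- p) ℚ.- (ℚ.- q) ∣ ≡ ℚ.∣ p ℚ.- q ∣
      eq p q = trans
        (cong ℚ.∣_∣ (solve 2 (λ p q → (:- p) :- (:- q) := :- (p :- q)) refl p q))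
        (ℚ.∣-p∣≡∣p∣ (p ℚ.- q))

    +-cauchy : ∀ {x y} → IsCauchy x → IsCauchy y → IsCauchy (λ n → x n ℚ.+ y n)
    +-cauchy {x} {y} cx cy ε 0<ε
      with cx (ε ℚ.* ½) (half-pos 0<ε) | cy (ε ℚ.* ½) (half-pos 0<ε)
    ... | N₁ , close₁ | N₂ , close₂ = N₁ ℕ.⊔ N₂ , λ m n N≤m N≤n →
      let (a , b) = common N≤m ; (c , d) = common N≤n in begin-strict
      ℚ.∣ (x m ℚ.+ y m) ℚ.- (x n ℚ.+ y n) ∣      ≡⟨ cong ℚ.∣_∣ (regroup (x m) (y m) (x n) (y n)) ⟩
      ℚ.∣ (x m ℚ.- x n) ℚ.+ (y m ℚ.- y n) ∣      ≤⟨ ℚ.∣p+q∣≤∣p∣+∣q∣ (x m ℚ.- x n) (y m ℚ.- y n) ⟩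
      ℚ.∣ x m ℚ.- x n ∣ ℚ.+ ℚ.∣ y m ℚ.- y n ∣    <⟨ ℚ.+-mono-< (close₁ m n a c) (close₂ m n b d) ⟩
      ε ℚ.* ½ ℚ.+ ε ℚ.* ½                        ≡⟨ halves ε ⟩
      ε                                          ∎
      where
      regroup : ∀ p q r s → (p ℚ.+ q) ℚ.- (r ℚ.+ s) ≡ (p ℚ.- r) ℚ.+ (q ℚ.- s)
      regroup = solve 4 (λ p q r s → (p :+ q) :- (r :+ s) := (p :- r) :+ (q :- s)) refl

    *-cauchy : ∀ {x y} → IsCauchy x → IsCauchy y → IsCauchy (λ n → x n ℚ.* y n)
    *-cauchy {x} {y} cx cy ε 0<ε =
      let (A , 0<A , N₁ , x≤A)  = eventually-bounded cx
          (B , 0<B , N₂ , y≤B)  = eventually-bounded cy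
          (δ , 0<δ , [A+B]δ≡ε)  = divide (ℚ.+-mono-< 0<A 0<B) 0<ε
          (M₁ , close₁)         = cx δ 0<δ
          (M₂ , close₂)         = cy δ 0<δ
      in (N₁ ℕ.⊔ N₂) ℕ.⊔ (M₁ ℕ.⊔ M₂) , λ m n N≤m N≤n →
        let (u , v) = common N≤m ; (w , z) = common N≤n
            (a , _) = common {N₁} u ; (_ , b) = common {N₁} w
            (c , d) = common {M₁} v ; (e , f) = common {M₁} z
        in subst (ℚ.∣ x m ℚ.* y m ℚ.- x n ℚ.* y n ∣ ℚ.<_) [A+B]δ≡ε
             (*-dist (x m) (y m) (x n) (y n) 0<A 0<B (x≤A m a) (y≤B n b)
               (close₁ m n c e) (close₂ m n d f))

    ⊔-cauchy : ∀ {x y} → IsCauchy x → IsCauchy y → IsCauchy (λ n → x n ℚ.⊔ y n)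
    ⊔-cauchy {x} {y} cx cy ε 0<ε with cx ε 0<ε | cy ε 0<ε
    ... | N₁ , close₁ | N₂ , close₂ = N₁ ℕ.⊔ N₂ , λ m n N≤m N≤n →
      let (a , b) = common N≤m ; (c , d) = common N≤n in
      ∣∣-bound ((x m ℚ.⊔ y m) ℚ.- (x n ℚ.⊔ y n))
        (⊔-dist (x m) (y m) (x n) (y n) (close₁ m n a c) (close₂ m n b d))
        (subst (ℚ._< ε) (sym (swap-sub (x m ℚ.⊔ y m) (x n ℚ.⊔ y n)))
          (⊔-dist (x n) (y n) (x m) (y m) (close₁ n m c a) (close₂ n m d b)))

infix  8 -_
infixl 7 _*_
infixl 6 _+_ _-_ _⊔_

fromℚ : ℚ → ℝ
fromℚ q = mkℝ (λ _ → q) (const-cauchy q)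

0ℝ 1ℝ 2ℝ : ℝ
0ℝ = fromℚ 0ℚ
1ℝ = fromℚ 1ℚ
2ℝ = fromℚ (1ℚ ℚ.+ 1ℚ)

-_ : ℝ → ℝ
- x = mkℝ (λ n → ℚ.- seq x n) (neg-cauchy {seq x} (cauchy x))

_+_ _-_ _*_ _⊔_ : ℝ → ℝ → ℝ
x + y = mkℝ (λ n → seq x n ℚ.+ seq y n) (+-cauchy {seq x} {seq y} (cauchy x) (cauchy y))
x - y = x + (- y)
x * y = mkℝ (λ n → seq x n ℚ.* seq y n) (*-cauchy {seq x} {seq y} (cauchy x) (cauchy y))
x ⊔ y = mkℝ (λ n → seq x n ℚ.⊔ seq y n) (⊔-cauchy {seq x} {seq y} (cauchy x) (cauchy y))

∣_∣ : ℝ → ℝ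
∣ x ∣ = x ⊔ (- x)

infixl 9 _²

_² : ℝ → ℝ
x ² = x * x

+-0-rawMonoid : RawMonoid 0ℓ 0ℓ
+-0-rawMonoid = record { Carrier = ℝ ; _≈_ = _≃_ ; _∙_ = _+_ ; ε = 0ℝ }

∑ : ∀ n → Vector ℝ n → ℝ
∑ n = Sum.sum +-0-rawMonoid {n}

infixl 6 ∑
syntax ∑ n (λ i → e) = ∑[ i < n ] e

maximum : ∀ {n} .{{_ : ℕ.NonZero n}} → Vector ℝ n → ℝ
maximum {1}           v = v zero
maximum {suc (suc n)} v = v zero ⊔ maximum (λ i → v (suc i))

------------------------------------------------------------------------
-- The penalised assignment problem

Matrix : ℕ → Set
Matrix n = Fin n → Fin n → ℝ

module _ {n : ℕ} where

  rowSum colSum : Matrix n → Fin n → ℝ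
  rowSum x i = ∑[ j < n ] x i j
  colSum x j = ∑[ i < n ] x i j

  ρ κ : Matrix n → Fin n → ℝ
  ρ x i = rowSum x i - 1ℝ
  κ x j = colSum x j - 1ℝ

  Vdeg : Matrix n → ℝ
  Vdeg x = (∑[ i < n ] (ρ x i ²)) + (∑[ j < n ] (κ x j ²))
         - 2ℝ * (∑[ i < n ] (∑[ j < n ] (x i j ²)))
         + 2ℝ * (∑[ i < n ] (∑[ j < n ] x i j))

  f̂deg : (c : Matrix n) (ε γ : ℝ) → Matrix n → ℝ
  f̂deg c ε γ x = (∑[ i < n ] (∑[ j < n ] (c i j * x i j)))
               + ε * (∑[ i < n ] (∑[ j < n ] x i j))
               + γ * Vdeg x

  cmax : .{{_ : ℕ.NonZero n}} → Matrix n → ℝ → ℝ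
  cmax c ε = maximum (λ i → maximum (λ j → c i j)) + ε

  InUnitBox : Matrix n → Set
  InUnitBox x = ∀ i j → (0ℝ ≤ x i j) × (x i j ≤ 1ℝ)

  -- Neighbourhoods are taken in the sup norm; all norms on ℝⁿˣⁿ give the same
  -- notion.
  IsLocalMinimizerOver : (Matrix n → Set) → (Matrix n → ℝ) → Matrix n → Set
  IsLocalMinimizerOver S f x = S x ×
    (Σ[ δ ∈ ℝ ] 0ℝ < δ ×
      (∀ y → S y → (∀ i j → ∣ y i j - x i j ∣ < δ) → f x ≤ f y))

  record AssignmentFeasible (x : Matrix n) : Set where
    field
      rows   : ∀ i → rowSum x i ≃ 1ℝ
      cols   : ∀ j → colSum x j ≃ 1ℝ
      binary : ∀ i j → x i j ≃ 0ℝ ⊎ x i j ≃ 1ℝ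

3≤⇒nonZero : ∀ {n} → 3 ℕ.≤ n → ℕ.NonZero n
3≤⇒nonZero 3≤n = ℕ.>-nonZero (ℕ.≤-trans (s≤s z≤n) 3≤n)

{-# OPTIONS --safe #-}

-- The objective is affine in each single entry, with slope
-- cᵢⱼ + ε + 2γ(aᵢⱼ + bᵢⱼ − 1), where aᵢⱼ and bᵢⱼ are the sums of the other entries
-- of row i and of column j.  Along eᵢⱼ − eₖₗ, for two entries in a common row or
-- column, its second difference is −4γt², so at a local minimizer x no line has two
-- entries strictly between 0 and 1.  If all other entries of row i and column j
-- are 0 or 1, then aᵢⱼ + bᵢⱼ is 0 or at least 1, and since 0 < cᵢⱼ + ε < γ the slope
-- is negative or positive accordingly: xᵢⱼ > 0 forces aᵢⱼ = bᵢⱼ = 0, and xᵢⱼ < 1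
-- excludes it.  Hence every entry is 0 or 1, and a line through an entry 1 sums to 1.
-- An empty row makes every column nonempty, so all columns sum to 1, and then so do
-- all rows because both families have the same total.
--
-- Constructively, "x = 0 or x = 1" is decided by a rational approximation of x,
-- after which "x is not strictly between 0 and 1" suffices: the moduli of
-- convergence make equality of reals stable under double negation.

module Submission where

open import Defs
open import Algebra.Bundles using (CommutativeMonoid)
open import Data.Fin.Base using (Fin; zero; suc; punchIn)
import Data.Fin.Properties as Fin
open import Data.Nat.Base as ℕ using (ℕ; zero; suc)
import Data.Nat.Properties as ℕ
open import Data.Product.Base using (_×_; _,_; proj₁; proj₂; Σ-syntax; ∃-syntax)
open import Data.Rational.Base as ℚ using (ℚ; 0ℚ; 1ℚ; ½)
import Data.Rational.Properties as ℚ
open import Data.Rational.Solver using (module +-*-Solver)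
open import Data.Sum.Base as ⊎ using (_⊎_; inj₁; inj₂)
open import Data.Vec.Functional using (Vector; removeAt; updateAt)
open import Data.Vec.Functional.Properties using (updateAt-updates; updateAt-minimal)
open import Function.Base using (_∘_)
open import Level using (0ℓ)
open import Relation.Binary.PropositionalEquality as ≡ using (_≡_; _≢_; refl)
import Relation.Binary.Reasoning.Setoid as SetoidReasoning
open import Relation.Nullary.Decidable using (yes; no; from-yes)
open import Relation.Nullary.Negation using (¬_; contradiction)
open +-*-Solver

-- Rational inequalities

0<½* : ∀ {ε} → 0ℚ ℚ.< ε → 0ℚ ℚ.< ε ℚ.* ½
0<½* {ε} 0<ε = ≡.subst (ℚ._< ε ℚ.* ½) (ℚ.*-zeroˡ ½) (ℚ.*-monoˡ-<-pos ½ 0<ε)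

-- Both inequalities say that the same difference is positive. This reduces a linear inequality to a
-- ring identity, which the solver proves.
<-rearrange : ∀ {p q p′ q′} → p ℚ.< q → q ℚ.- p ≡ q′ ℚ.- p′ → p′ ℚ.< q′
<-rearrange {p} {q} {p′} {q′} p<q eq = ≡.subst₂ ℚ._<_
  (solve 2 (λ p p′ → p :+ (p′ :- p) := p′) refl p p′)
  (≡.trans (solve 3 (λ p q p′ → q :+ (p′ :- p) := (q :- p) :+ p′) refl p q p′)
    (≡.trans (≡.cong (ℚ._+ p′) eq) (solve 2 (λ q′ p′ → (q′ :- p′) :+ p′ := q′) refl q′ p′)))
  (ℚ.+-monoˡ-< (p′ ℚ.- p) p<q)

p≤∣p∣ : ∀ p → p ℚ.≤ ℚ.∣ p ∣
p≤∣p∣ p with ℚ.≤-total 0ℚ p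
... | inj₁ 0≤p = ℚ.≤-reflexive (≡.sym (ℚ.0≤p⇒∣p∣≡p 0≤p))
... | inj₂ p≤0 = ℚ.≤-trans p≤0 (ℚ.0≤∣p∣ p)

∣p∣<q⇒p<q : ∀ p {q} → ℚ.∣ p ∣ ℚ.< q → p ℚ.< q
∣p∣<q⇒p<q p = ℚ.≤-<-trans (p≤∣p∣ p)

p<q∧-p<q⇒∣p∣<q : ∀ p {q} → p ℚ.< q → ℚ.- p ℚ.< q → ℚ.∣ p ∣ ℚ.< q
p<q∧-p<q⇒∣p∣<q p p<q -p<q with ℚ.∣p∣≡p∨∣p∣≡-p p
... | inj₁ eq = ≡.subst (ℚ._< _) (≡.sym eq) p<q
... | inj₂ eq = ≡.subst (ℚ._< _) (≡.sym eq) -p<q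

*-pos : ∀ {p q} → 0ℚ ℚ.< p → 0ℚ ℚ.< q → 0ℚ ℚ.< p ℚ.* q
*-pos {p} {q} 0<p 0<q =
  ≡.subst (ℚ._< p ℚ.* q) (ℚ.*-zeroʳ p) (ℚ.*-monoʳ-<-pos p {{ℚ.positive 0<p}} 0<q)

*-mono-<-pos : ∀ {p q r s} → 0ℚ ℚ.< p → 0ℚ ℚ.< q → p ℚ.< r → q ℚ.< s → p ℚ.* q ℚ.< r ℚ.* s
*-mono-<-pos {p} {q} {r} {s} 0<p 0<q p<r q<s = ℚ.<-trans
  (ℚ.*-monoʳ-<-pos p {{ℚ.positive 0<p}} q<s)
  (ℚ.*-monoˡ-<-pos s {{ℚ.positive (ℚ.<-trans 0<q q<s)}} p<r)

divide : ∀ {p q} → 0ℚ ℚ.< p → 0ℚ ℚ.< q → Σ[ r ∈ ℚ ] 0ℚ ℚ.< r × p ℚ.* r ≡ q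
divide {p} {q} 0<p 0<q =
  ℚ.1/ p ℚ.* q ,
  *-pos (ℚ.positive⁻¹ (ℚ.1/ p) {{ℚ.1/pos⇒pos p}}) 0<q ,
  ≡.trans (≡.sym (ℚ.*-assoc p (ℚ.1/ p) q))
    (≡.trans (≡.cong (ℚ._* q) (ℚ.*-inverseʳ p)) (ℚ.*-identityˡ q))
  where
  instance
    p-pos : ℚ.Positive p
    p-pos = ℚ.positive 0<p
    p-nonZero : ℚ.NonZero p
    p-nonZero = ℚ.pos⇒nonZero p

-- Equality and order of real numbers

Eventually : (ℕ → Set) → Set
Eventually P = ∃[ N ] (∀ n → N ℕ.≤ n → P n)

ev-map : ∀ {P Q} → (∀ n → P n → Q n) → Eventually P → Eventually Q
ev-map f (N , p) = N , λ n N≤n → f n (p n N≤n)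

ev-zip : ∀ {P Q R} → (∀ n → P n → Q n → R n) → Eventually P → Eventually Q → Eventually R
ev-zip f (M , p) (N , q) = M ℕ.⊔ N , λ n M⊔N≤n →
  f n (p n (ℕ.m⊔n≤o⇒m≤o M N M⊔N≤n)) (q n (ℕ.m⊔n≤o⇒n≤o M N M⊔N≤n))

-- Unlike _≃_, _<_ and _≤_, which unfold to statements about sequences, the
-- records _≈_, Pos and NonNeg determine their arguments for unification.

infix 4 _≈_

record _≈_ (x y : ℝ) : Set where
  constructor mk≈
  field un≈ : x ≃ y

record Pos (x : ℝ) : Set where
  constructor mkPos
  field unPos : 0ℝ < x

record NonNeg (x : ℝ) : Set where
  constructor mkNonNeg
  field ¬neg : ¬ Pos (- x)

open _≈_
open Pos
open NonNeg

-- Arithmetic on reals acts termwise on the sequences, so the rational ring solver proves real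
-- identities through this lemma.
pointwise : ∀ {x y} → (∀ n → seq x n ≡ seq y n) → x ≈ y
pointwise {x} {y} eq = mk≈ λ ε 0<ε → 0 , λ n _ → ≡.subst (ℚ._< ε)
  (≡.cong ℚ.∣_∣ (≡.sym (≡.trans (≡.cong (ℚ._- seq y n) (eq n)) (ℚ.+-inverseʳ (seq y n)))))
  0<ε

≈-refl : ∀ {x} → x ≈ x
≈-refl = pointwise λ _ → refl

≈-sym : ∀ {x y} → x ≈ y → y ≈ x
≈-sym {x} {y} (mk≈ x≃y) = mk≈ λ ε 0<ε → ev-map (λ n → ≡.subst (ℚ._< ε)
  (≡.trans (≡.sym (ℚ.∣-p∣≡∣p∣ (seq x n ℚ.- seq y n))) (≡.cong ℚ.∣_∣
    (solve 2 (λ p q → :- (p :- q) := q :- p) refl (seq x n) (seq y n))))) (x≃y ε 0<ε)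

∣p+q∣<ε : ∀ p q {ε} → ℚ.∣ p ∣ ℚ.< ε ℚ.* ½ → ℚ.∣ q ∣ ℚ.< ε ℚ.* ½ → ℚ.∣ p ℚ.+ q ∣ ℚ.< ε
∣p+q∣<ε p q {ε} ∣p∣< ∣q∣< = ℚ.≤-<-trans (ℚ.∣p+q∣≤∣p∣+∣q∣ p q)
  (≡.subst (_ ℚ.<_) (solve 1 (λ ε → ε :* con ½ :+ ε :* con ½ := ε) refl ε)
    (ℚ.+-mono-< ∣p∣< ∣q∣<))

≈-trans : ∀ {x y z} → x ≈ y → y ≈ z → x ≈ z
≈-trans {x} {y} {z} (mk≈ x≃y) (mk≈ y≃z) = mk≈ λ ε 0<ε →
  ev-zip (λ n p q → ≡.subst (λ r → ℚ.∣ r ∣ ℚ.< ε)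
    (solve 3 (λ p q r → (p :- q) :+ (q :- r) := p :- r) refl (seq x n) (seq y n) (seq z n))
    (∣p+q∣<ε (seq x n ℚ.- seq y n) (seq y n ℚ.- seq z n) p q))
  (x≃y (ε ℚ.* ½) (0<½* 0<ε)) (y≃z (ε ℚ.* ½) (0<½* 0<ε))

+-cong : ∀ {x y u v} → x ≈ y → u ≈ v → x + u ≈ y + v
+-cong {x} {y} {u} {v} (mk≈ x≃y) (mk≈ u≃v) = mk≈ λ ε 0<ε →
  ev-zip (λ n p q → ≡.subst (λ r → ℚ.∣ r ∣ ℚ.< ε)
    (solve 4 (λ x y u v → (x :- y) :+ (u :- v) := (x :+ u) :- (y :+ v)) refl
      (seq x n) (seq y n) (seq u n) (seq v n))
    (∣p+q∣<ε (seq x n ℚ.- seq y n) (seq u n ℚ.- seq v n) p q))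
  (x≃y (ε ℚ.* ½) (0<½* 0<ε)) (u≃v (ε ℚ.* ½) (0<½* 0<ε))

-‿cong : ∀ {x y} → x ≈ y → - x ≈ - y
-‿cong {x} {y} (mk≈ x≃y) = mk≈ λ ε 0<ε → ev-map (λ n → ≡.subst (ℚ._< ε)
  (≡.trans (≡.sym (ℚ.∣-p∣≡∣p∣ (seq x n ℚ.- seq y n))) (≡.cong ℚ.∣_∣
    (solve 2 (λ p q → :- (p :- q) := (:- p) :- (:- q)) refl (seq x n) (seq y n)))))
  (x≃y ε 0<ε)

seq-bounded : ∀ x → Σ[ B ∈ ℚ ] 0ℚ ℚ.< B × Eventually (λ n → ℚ.∣ seq x n ∣ ℚ.≤ B)
seq-bounded x =
  let (N , close) = cauchy x 1ℚ (ℚ.positive⁻¹ 1ℚ) ; ∣xN∣ = ℚ.∣ seq x N ∣ in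
  1ℚ ℚ.+ ∣xN∣ , ℚ.+-mono-<-≤ (ℚ.positive⁻¹ 1ℚ) (ℚ.0≤∣p∣ (seq x N)) ,
  N , λ n N≤n → ℚ.≤-trans
    (ℚ.≤-reflexive (≡.cong ℚ.∣_∣
      (solve 2 (λ p q → p := (p :- q) :+ q) refl (seq x n) (seq x N))))
    (ℚ.≤-trans (ℚ.∣p+q∣≤∣p∣+∣q∣ (seq x n ℚ.- seq x N) (seq x N))
      (ℚ.+-monoˡ-≤ ∣xN∣ (ℚ.<⇒≤ (close n N N≤n ℕ.≤-refl))))

-- With `z` eventually bounded by `B`, it suffices that `x` and `y` come closer than `ε` divided by
-- `B`.
*-congˡ : ∀ z {x y} → x ≈ y → z * x ≈ z * y
*-congˡ z {x} {y} (mk≈ x≃y) = mk≈ λ ε 0<ε →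
  let (B , 0<B , bound)  = seq-bounded z
      (δ , 0<δ , Bδ≡ε)   = divide 0<B 0<ε
  in ev-zip (λ n ∣z∣≤B ∣x-y∣<δ → let d = seq x n ℚ.- seq y n in
       ≡.subst₂ ℚ._<_
         (≡.trans (≡.sym (ℚ.∣p*q∣≡∣p∣*∣q∣ (seq z n) d)) (≡.cong ℚ.∣_∣
           (solve 3 (λ z x y → z :* (x :- y) := z :* x :- z :* y) refl
             (seq z n) (seq x n) (seq y n))))
         Bδ≡ε
         (ℚ.≤-<-trans (ℚ.*-monoʳ-≤-nonNeg ℚ.∣ d ∣ {{ℚ.∣-∣-nonNeg d}} ∣z∣≤B)
           (ℚ.*-monoʳ-<-pos B {{ℚ.positive 0<B}} ∣x-y∣<δ)))
     bound (x≃y δ 0<δ)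

*-comm : ∀ x y → x * y ≈ y * x
*-comm x y = pointwise λ n → ℚ.*-comm (seq x n) (seq y n)

*-cong : ∀ {x y u v} → x ≈ y → u ≈ v → x * u ≈ y * v
*-cong {x} {y} {u} {v} x≈y u≈v =
  ≈-trans (*-congˡ x u≈v) (≈-trans (*-comm x v) (≈-trans (*-congˡ v x≈y) (*-comm v y)))

+-0-commutativeMonoid : CommutativeMonoid 0ℓ 0ℓ
+-0-commutativeMonoid = record
  { Carrier = ℝ ; _≈_ = _≈_ ; _∙_ = _+_ ; ε = 0ℝ
  ; isCommutativeMonoid = record
    { isMonoid = record
      { isSemigroup = record
        { isMagma = record
          { isEquivalence = record { refl = ≈-refl ; sym = ≈-sym ; trans = ≈-trans }
          ; ∙-cong = +-cong }
        ; assoc = λ x y z → pointwise λ n → ℚ.+-assoc (seq x n) (seq y n) (seq z n) }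
      ; identity = (λ x → pointwise λ n → ℚ.+-identityˡ (seq x n))
                 , (λ x → pointwise λ n → ℚ.+-identityʳ (seq x n)) }
    ; comm = λ x y → pointwise λ n → ℚ.+-comm (seq x n) (seq y n) } }

open CommutativeMonoid +-0-commutativeMonoid using () renaming (setoid to ≈-setoid; identityˡ to +-identityˡ; identityʳ to +-identityʳ)
-- Its `sum` folds `_+_` from `0ℝ` exactly as `∑` does, so its lemmas apply to `∑` by definition.
import Algebra.Properties.CommutativeMonoid.Sum +-0-commutativeMonoid as Sum

-- Signs of real numbers

<-resp-difference : ∀ {x y x′ y′} → y - x ≈ y′ - x′ → x < y → x′ < y′
<-resp-difference {x} {y} {x′} {y′} (mk≈ eq) (ε , 0<ε , x+ε<y) =
  -- Half of the gap absorbs the eventual error of `eq`; the other half remains as the new gap.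
  ε ℚ.* ½ , 0<½* 0<ε , ev-zip step x+ε<y (eq (ε ℚ.* ½) (0<½* 0<ε))
  where
  step : ∀ n → seq x n ℚ.+ ε ℚ.< seq y n →
         ℚ.∣ (seq y n ℚ.- seq x n) ℚ.- (seq y′ n ℚ.- seq x′ n) ∣ ℚ.< ε ℚ.* ½ →
         seq x′ n ℚ.+ ε ℚ.* ½ ℚ.< seq y′ n
  step n x+ε<y near = <-rearrange
    (ℚ.+-mono-< x+ε<y (∣p∣<q⇒p<q ((seq y n ℚ.- seq x n) ℚ.- (seq y′ n ℚ.- seq x′ n)) near))
    (solve 5 (λ x y x′ y′ ε →
        (y :+ ε :* con ½) :- (x :+ ε :+ ((y :- x) :- (y′ :- x′))) := y′ :- (x′ :+ ε :* con ½))
      refl (seq x n) (seq y n) (seq x′ n) (seq y′ n) ε)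

<⇒Pos : ∀ x y → x < y → Pos (y - x)
<⇒Pos x y = mkPos ∘ <-resp-difference {x} {y} {0ℝ} {y - x} (pointwise λ n →
  solve 2 (λ x y → y :- x := (y :- x) :- con 0ℚ) refl (seq x n) (seq y n))

Pos⇒< : ∀ x y → Pos (y - x) → x < y
Pos⇒< x y = <-resp-difference {0ℝ} {y - x} {x} {y} (pointwise λ n →
  solve 2 (λ x y → (y :- x) :- con 0ℚ := y :- x) refl (seq x n) (seq y n)) ∘ unPos

Pos-resp : ∀ {x y} → x ≈ y → Pos x → Pos y
Pos-resp {x} {y} x≈y (mkPos 0<x) =
  mkPos (<-resp-difference {0ℝ} {x} {0ℝ} {y} (+-cong x≈y ≈-refl) 0<x)

NonNeg-resp : ∀ {x y} → x ≈ y → NonNeg x → NonNeg y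
NonNeg-resp x≈y (mkNonNeg ¬neg) = mkNonNeg (¬neg ∘ Pos-resp (-‿cong (≈-sym x≈y)))

≤⇒NonNeg : ∀ x y → x ≤ y → NonNeg (y - x)
≤⇒NonNeg x y x≤y = mkNonNeg λ neg → x≤y (Pos⇒< y x (Pos-resp (pointwise λ n →
  solve 2 (λ x y → :- (y :- x) := x :- y) refl (seq x n) (seq y n)) neg))

NonNeg⇒≤ : ∀ x y → NonNeg (y - x) → x ≤ y
NonNeg⇒≤ x y (mkNonNeg ¬neg) y<x = ¬neg (Pos-resp (pointwise λ n →
  solve 2 (λ x y → x :- y := :- (y :- x)) refl (seq x n) (seq y n)) (<⇒Pos y x y<x))

x-0≈x : ∀ x → x - 0ℝ ≈ x
x-0≈x x = pointwise λ n → ℚ.+-identityʳ (seq x n)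

0≤⇒NonNeg : ∀ {x} → 0ℝ ≤ x → NonNeg x
0≤⇒NonNeg {x} = NonNeg-resp (x-0≈x x) ∘ ≤⇒NonNeg 0ℝ x

pos-pointwise : ∀ {x q} → 0ℚ ℚ.< q → Eventually (λ n → q ℚ.< seq x n) → Pos x
pos-pointwise {x} {q} 0<q ev = mkPos (q , 0<q ,
  ev-map (λ n → ≡.subst (ℚ._< seq x n) (≡.sym (ℚ.+-identityˡ q))) ev)

pos-bound : ∀ {x} → Pos x → Σ[ q ∈ ℚ ] 0ℚ ℚ.< q × Eventually (λ n → q ℚ.< seq x n)
pos-bound {x} (mkPos (q , 0<q , ev)) =
  q , 0<q , ev-map (λ n → ≡.subst (ℚ._< seq x n) (ℚ.+-identityˡ q)) ev

-- This extracts positive information from a negated statement. Choose `N` so that later terms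
-- differ from `seq x N` by less than η/4. If `seq x N` is at most -η/2, all later terms lie below
-- -η/4 and `- x` is positive; otherwise they lie above -3η/4.
nonneg-bound : ∀ {x} → NonNeg x → ∀ η → 0ℚ ℚ.< η → Eventually (λ n → ℚ.- η ℚ.< seq x n)
nonneg-bound {x} (mkNonNeg ¬neg) η 0<η with cauchy x (η ℚ.* ½ ℚ.* ½) (0<½* (0<½* 0<η))
... | N , close with seq x N ℚ.≤? ℚ.- (η ℚ.* ½)
...   | yes xN≤ = contradiction
          (pos-pointwise (0<½* (0<½* 0<η)) (N , λ n N≤n → <-rearrange
            (ℚ.+-mono-≤-< xN≤ (∣p∣<q⇒p<q (seq x n ℚ.- seq x N) (close n N N≤n ℕ.≤-refl)))
            (solve 3 (λ η x xN → (:- (η :* con ½) :+ η :* con ½ :* con ½) :- (xN :+ (x :- xN)) :=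
                                 (:- x) :- (η :* con ½ :* con ½)) refl η (seq x n) (seq x N))))
          ¬neg
...   | no xN≰ = N , λ n N≤n → <-rearrange
          (ℚ.+-mono-< (ℚ.+-mono-< (ℚ.≰⇒> xN≰)
              (∣p∣<q⇒p<q (seq x N ℚ.- seq x n) (close N n ℕ.≤-refl N≤n)))
            (0<½* (0<½* 0<η)))
          (solve 3 (λ η x xN → (xN :+ η :* con ½ :* con ½ :+ η :* con ½ :* con ½) :-
                               (:- (η :* con ½) :+ (xN :- x) :+ con 0ℚ) := x :- (:- η))
            refl η (seq x n) (seq x N))

nonneg-pointwise : ∀ {x} → Eventually (λ n → 0ℚ ℚ.≤ seq x n) → NonNeg x
nonneg-pointwise {x} ev = mkNonNeg λ neg →
  let (q , 0<q , ev′) = pos-bound neg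
      (N , bound)     = ev-zip (λ n → _,_) ev ev′
      (0≤x , q<-x)    = bound N ℕ.≤-refl
  in ℚ.<-irrefl refl (ℚ.<-≤-trans (ℚ.<-trans 0<q q<-x) (ℚ.neg-antimono-≤ 0≤x))

pos⇒nonneg : ∀ {x} → Pos x → NonNeg x
pos⇒nonneg 0<x = let (q , 0<q , q<x) = pos-bound 0<x in
  nonneg-pointwise (ev-map (λ n → ℚ.<⇒≤ ∘ ℚ.<-trans 0<q) q<x)

pos+nonneg : ∀ {x y} → Pos x → NonNeg y → Pos (x + y)
pos+nonneg {x} {y} 0<x 0≤y =
  let (q , 0<q , q<x) = pos-bound 0<x in
  pos-pointwise (0<½* 0<q) (ev-zip (λ n q<x -½q<y → ≡.subst (ℚ._< seq x n ℚ.+ seq y n)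
      (solve 1 (λ q → q :+ :- (q :* con ½) := q :* con ½) refl q) (ℚ.+-mono-< q<x -½q<y))
    q<x (nonneg-bound 0≤y (q ℚ.* ½) (0<½* 0<q)))

nonneg+nonneg : ∀ {x y} → NonNeg x → NonNeg y → NonNeg (x + y)
nonneg+nonneg {x} {y} 0≤x 0≤y = mkNonNeg λ neg → ¬neg 0≤y (Pos-resp (pointwise λ n →
  solve 2 (λ x y → :- (x :+ y) :+ x := :- y) refl (seq x n) (seq y n)) (pos+nonneg neg 0≤x))

pos*pos : ∀ {x y} → Pos x → Pos y → Pos (x * y)
pos*pos 0<x 0<y =
  let (p , 0<p , p<x) = pos-bound 0<x
      (q , 0<q , q<y) = pos-bound 0<y
  in pos-pointwise (*-pos 0<p 0<q) (ev-zip (λ n → *-mono-<-pos 0<p 0<q) p<x q<y)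

-- The bounds of `nonneg-bound` for `x` and `- x` provide the modulus that `_≃_` asks for. Through
-- this lemma, refuting both signs of a real yields that it equals 0.
nonneg-antisym : ∀ {x} → NonNeg x → NonNeg (- x) → x ≈ 0ℝ
nonneg-antisym {x} 0≤x 0≤-x = mk≈ λ ε 0<ε → ev-zip
  (λ n -ε<x -ε<-x → let p = seq x n ℚ.- 0ℚ in p<q∧-p<q⇒∣p∣<q p
    (<-rearrange -ε<-x (solve 2 (λ x ε → (:- x) :- (:- ε) := ε :- (x :- con 0ℚ)) refl (seq x n) ε))
    (<-rearrange -ε<x (solve 2 (λ x ε → x :- (:- ε) := ε :- (:- (x :- con 0ℚ))) refl (seq x n) ε)))
  (nonneg-bound 0≤x ε 0<ε) (nonneg-bound 0≤-x ε 0<ε)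

¬pos⇒nonneg- : ∀ {x} → ¬ Pos x → NonNeg (- x)
¬pos⇒nonneg- {x} ¬0<x = mkNonNeg λ neg → ¬0<x (Pos-resp (pointwise λ n →
  solve 1 (λ x → :- (:- x) := x) refl (seq x n)) neg)

0≈⇒nonneg : ∀ {x} → x ≈ 0ℝ → NonNeg x
0≈⇒nonneg x≈0 = NonNeg-resp (≈-sym x≈0) (nonneg-pointwise (0 , λ _ _ → ℚ.≤-refl))

*-zeroʳ : ∀ z {x} → x ≈ 0ℝ → z * x ≈ 0ℝ
*-zeroʳ z x≈0 = ≈-trans (*-congˡ z x≈0) (pointwise λ n → ℚ.*-zeroʳ (seq z n))

-- If the product were negative, `y` could not be positive, hence would be 0, and so would the
-- product.
pos*nonneg : ∀ {x y} → Pos x → NonNeg y → NonNeg (x * y)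
pos*nonneg {x} {y} 0<x 0≤y = mkNonNeg λ neg →
  let ¬0<y = λ 0<y → ¬neg (pos⇒nonneg (pos*pos 0<x 0<y)) neg
      xy≈0 = *-zeroʳ x (nonneg-antisym 0≤y (¬pos⇒nonneg- ¬0<y))
  in ¬neg (0≈⇒nonneg xy≈0) neg

1-pos : Pos 1ℝ
1-pos = pos-pointwise (ℚ.positive⁻¹ ½) (0 , λ _ _ → from-yes (½ ℚ.<? 1ℚ))

-- Some term approximates all later ones within 1/4, and comparing it with 1/2 is decidable: either
-- the later terms stay below 3/4 or they exceed 1/4.
<1-or-0< : ∀ x → Pos (1ℝ - x) ⊎ Pos x
<1-or-0< x with cauchy x (½ ℚ.* ½) (ℚ.positive⁻¹ (½ ℚ.* ½))
... | N , close with seq x N ℚ.≤? ½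
...   | yes xN≤½ = inj₁ (pos-pointwise (0<½* (ℚ.positive⁻¹ (½ ℚ.* ½))) (N , λ n N≤n → <-rearrange
          (ℚ.+-mono-< (ℚ.+-mono-≤-< xN≤½
            (∣p∣<q⇒p<q (seq x n ℚ.- seq x N) (close n N N≤n ℕ.≤-refl)))
            (0<½* (ℚ.positive⁻¹ (½ ℚ.* ½))))
          (solve 2 (λ x xN →
              (con ½ :+ con (½ ℚ.* ½) :+ con (½ ℚ.* ½ ℚ.* ½)) :- (xN :+ (x :- xN) :+ con 0ℚ) :=
              (con 1ℚ :- x) :- con (½ ℚ.* ½ ℚ.* ½)) refl (seq x n) (seq x N))))
...   | no xN≰½ = inj₂ (pos-pointwise (ℚ.positive⁻¹ (½ ℚ.* ½)) (N , λ n N≤n → <-rearrange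
          (ℚ.+-mono-< (ℚ.≰⇒> xN≰½)
            (∣p∣<q⇒p<q (seq x N ℚ.- seq x n) (close N n ℕ.≤-refl N≤n)))
          (solve 2 (λ x xN → (xN :+ con (½ ℚ.* ½)) :- (con ½ :+ (xN :- x)) := x :- con (½ ℚ.* ½))
            refl (seq x n) (seq x N))))

≡⇒≈ : ∀ {x y} → x ≡ y → x ≈ y
≡⇒≈ refl = ≈-refl

-- Once the term at `i` is removed, the two sums agree term by term.
∑-change : ∀ {n} (f g : Vector ℝ n) i {d} →
  (∀ k → k ≢ i → g k ≈ f k) → g i ≈ f i + d → ∑ n g ≈ ∑ n f + d
∑-change {suc n} f g i {d} off at = begin
  ∑ (suc n) g                     ≈⟨ Sum.sum-remove {i = i} g ⟩
  g i + ∑ n (removeAt g i)        ≈⟨ +-cong at (Sum.sum-cong-≋ λ k → off (punchIn i k) (Fin.punchInᵢ≢i i k)) ⟩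
  (f i + d) + ∑ n (removeAt f i)  ≈⟨ pointwise (λ m → solve 3 (λ a b d → (a :+ d) :+ b := (a :+ b) :+ d) refl
                                       (seq (f i) m) (seq (∑ n (removeAt f i)) m) (seq d m)) ⟩
  (f i + ∑ n (removeAt f i)) + d  ≈⟨ +-cong (Sum.sum-remove {i = i} f) ≈-refl ⟨
  ∑ (suc n) f + d                 ∎
  where open SetoidReasoning ≈-setoid

-- Moving a single entry

module _ {n : ℕ} where

  bump : Matrix n → Fin n → Fin n → ℝ → Matrix n
  bump x i j t = updateAt x i (λ row → updateAt row j (_+ t))

  bump-at : ∀ x i j t → bump x i j t i j ≡ x i j + t
  bump-at x i j t =
    ≡.trans (≡.cong (λ row → row j) (updateAt-updates i x)) (updateAt-updates j (x i))

  bump-off-row : ∀ x {i} j t {k} → k ≢ i → bump x i j t k ≡ x k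
  bump-off-row x {i} j t {k} = updateAt-minimal k i x

  bump-off-col : ∀ x i {j} t k {l} → l ≢ j → bump x i j t k l ≡ x k l
  bump-off-col x i {j} t k {l} l≢j with k Fin.≟ i
  ... | no k≢i   = ≡.cong (λ row → row l) (bump-off-row x j t k≢i)
  ... | yes refl = ≡.trans (≡.cong (λ row → row l) (updateAt-updates i x))
                     (updateAt-minimal l j (x i) l≢j)

  bump-elim : (P : Fin n → Fin n → ℝ → Set) → ∀ x i j t →
    (∀ k l → P k l (x k l)) → P i j (x i j + t) → ∀ k l → P k l (bump x i j t k l)
  bump-elim P x i j t off at k l with k Fin.≟ i | l Fin.≟ j
  ... | no k≢i   | _        =
    ≡.subst (P k l) (≡.sym (≡.cong (λ row → row l) (bump-off-row x j t k≢i))) (off k l)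
  ... | yes _    | no l≢j   = ≡.subst (P k l) (≡.sym (bump-off-col x i t k l≢j)) (off k l)
  ... | yes refl | yes refl = ≡.subst (P i j) (≡.sym (bump-at x i j t)) at

  module _ (x : Matrix n) (i j : Fin n) (t : ℝ) where

    private
      y = bump x i j t

    bump-row-∑ : (h : Fin n → ℝ → ℝ) → ∀ {d} → h j (x i j + t) ≈ h j (x i j) + d →
      ∑[ l < n ] h l (y i l) ≈ (∑[ l < n ] h l (x i l)) + d
    bump-row-∑ h eq = ∑-change (λ l → h l (x i l)) (λ l → h l (y i l)) j
      (λ l l≢j → ≡⇒≈ (≡.cong (h l) (bump-off-col x i t i l≢j)))
      (≈-trans (≡⇒≈ (≡.cong (h j) (bump-at x i j t))) eq)

    -- A general summand `h` lets one lemma serve the cost sum, the total and the sum of squares in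
    -- the objective.
    bump-∑∑ : (h : Fin n → Fin n → ℝ → ℝ) → ∀ {d} → h i j (x i j + t) ≈ h i j (x i j) + d →
      ∑[ k < n ] (∑[ l < n ] h k l (y k l)) ≈ (∑[ k < n ] (∑[ l < n ] h k l (x k l))) + d
    bump-∑∑ h eq = ∑-change (λ k → ∑ n λ l → h k l (x k l)) (λ k → ∑ n λ l → h k l (y k l)) i
      (λ k k≢i → ≡⇒≈ (≡.cong (λ row → ∑ n λ l → h k l (row l)) (bump-off-row x j t k≢i)))
      (bump-row-∑ (h i) eq)

    rowSum-bump-at : rowSum y i ≈ rowSum x i + t
    rowSum-bump-at = bump-row-∑ (λ _ v → v) ≈-refl

    rowSum-bump-off : ∀ {k} → k ≢ i → rowSum y k ≈ rowSum x k
    rowSum-bump-off k≢i = ≡⇒≈ (≡.cong (∑ n) (bump-off-row x j t k≢i))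

    colSum-bump-at : colSum y j ≈ colSum x j + t
    colSum-bump-at = ∑-change (λ k → x k j) (λ k → y k j) i
      (λ k k≢i → ≡⇒≈ (≡.cong (λ row → row j) (bump-off-row x j t k≢i)))
      (≡⇒≈ (bump-at x i j t))

    colSum-bump-off : ∀ {l} → l ≢ j → colSum y l ≈ colSum x l
    colSum-bump-off l≢j = Sum.sum-cong-≋ λ k → ≡⇒≈ (bump-off-col x i t k l≢j)

    ∑ρ²-bump : ∑[ k < n ] (ρ y k ²) ≈ (∑[ k < n ] (ρ x k ²)) + (2ℝ * ρ x i * t + t ²)
    ∑ρ²-bump = ∑-change (λ k → ρ x k ²) (λ k → ρ y k ²) i
      (λ k k≢i → let eq = +-cong (rowSum-bump-off k≢i) ≈-refl in *-cong eq eq)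
      (≈-trans (*-cong ρ-at ρ-at) (pointwise λ m →
        solve 2 (λ r t → (r :+ t :- con 1ℚ) :* (r :+ t :- con 1ℚ) :=
            (r :- con 1ℚ) :* (r :- con 1ℚ) :+ (con (1ℚ ℚ.+ 1ℚ) :* (r :- con 1ℚ) :* t :+ t :* t))
          refl (seq (rowSum x i) m) (seq t m)))
      where
      ρ-at : ρ y i ≈ rowSum x i + t - 1ℝ
      ρ-at = +-cong rowSum-bump-at ≈-refl

    ∑κ²-bump : ∑[ l < n ] (κ y l ²) ≈ (∑[ l < n ] (κ x l ²)) + (2ℝ * κ x j * t + t ²)
    ∑κ²-bump = ∑-change (λ l → κ x l ²) (λ l → κ y l ²) j
      (λ l l≢j → let eq = +-cong (colSum-bump-off l≢j) ≈-refl in *-cong eq eq)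
      (≈-trans (*-cong κ-at κ-at) (pointwise λ m →
        solve 2 (λ r t → (r :+ t :- con 1ℚ) :* (r :+ t :- con 1ℚ) :=
            (r :- con 1ℚ) :* (r :- con 1ℚ) :+ (con (1ℚ ℚ.+ 1ℚ) :* (r :- con 1ℚ) :* t :+ t :* t))
          refl (seq (colSum x j) m) (seq t m)))
      where
      κ-at : κ y j ≈ colSum x j + t - 1ℝ
      κ-at = +-cong colSum-bump-at ≈-refl

  -- The objective along one coordinate

  module Objective (c : Matrix n) (ε γ : ℝ) where

    -- This is the partial derivative of `f̂deg` with respect to the entry at `i`, `j`.
    slope : Matrix n → Fin n → Fin n → ℝ
    slope x i j = c i j + ε + 2ℝ * γ * (ρ x i + κ x j - 2ℝ * x i j + 1ℝ)

    -- The terms t² coming from ρᵢ² and κⱼ² cancel against the one from −2xᵢⱼ², so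
    -- the objective is affine in each single entry.
    f̂deg-bump : ∀ x i j t →
      f̂deg c ε γ (bump x i j t) ≈ f̂deg c ε γ x + t * slope x i j
    f̂deg-bump x i j t = ≈-trans
      (+-cong (+-cong C (*-congˡ ε S))
        (*-congˡ γ (+-cong (+-cong (+-cong (∑ρ²-bump x i j t) (∑κ²-bump x i j t))
          (-‿cong (*-congˡ 2ℝ Q))) (*-congˡ 2ℝ S))))
      (pointwise λ m → solve 12
        (λ C S R K Q c ε γ r k x t → let two = con (1ℚ ℚ.+ 1ℚ) in
          (C :+ c :* t) :+ ε :* (S :+ t) :+ γ :* ((R :+ (two :* r :* t :+ t :* t)) :+
            (K :+ (two :* k :* t :+ t :* t)) :- two :* (Q :+ (two :* x :* t :+ t :* t)) :+
            two :* (S :+ t))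
          := (C :+ ε :* S :+ γ :* (R :+ K :- two :* Q :+ two :* S)) :+
             t :* (c :+ ε :+ two :* γ :* (r :+ k :- two :* x :+ con 1ℚ)))
        refl
        (seq (∑[ k < n ] (∑[ l < n ] (c k l * x k l))) m)
        (seq (∑[ k < n ] (∑[ l < n ] x k l)) m)
        (seq (∑[ k < n ] (ρ x k ²)) m) (seq (∑[ l < n ] (κ x l ²)) m)
        (seq (∑[ k < n ] (∑[ l < n ] (x k l ²))) m)
        (seq (c i j) m) (seq ε m) (seq γ m) (seq (ρ x i) m) (seq (κ x j) m) (seq (x i j) m) (seq t m))
      where
      C = bump-∑∑ x i j t (λ k l v → c k l * v) {c i j * t} (pointwise λ m →
        ℚ.*-distribˡ-+ (seq (c i j) m) (seq (x i j) m) (seq t m))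
      S = bump-∑∑ x i j t (λ _ _ v → v) ≈-refl
      Q = bump-∑∑ x i j t (λ _ _ v → v ²) {2ℝ * x i j * t + t ²} (pointwise λ m →
        solve 2 (λ x t → (x :+ t) :* (x :+ t) :=
          x :* x :+ (con (1ℚ ℚ.+ 1ℚ) :* x :* t :+ t :* t)) refl (seq (x i j) m) (seq t m))

-- Sums of entries 0 and 1

Binary : ℝ → Set
Binary x = x ≈ 0ℝ ⊎ x ≈ 1ℝ

1-x≈1 : ∀ {x} → x ≈ 0ℝ → 1ℝ - x ≈ 1ℝ
1-x≈1 x≈0 = ≈-trans (+-cong ≈-refl (-‿cong x≈0)) (pointwise λ _ → refl)

binary⇒nonneg : ∀ {x} → Binary x → NonNeg x
binary⇒nonneg (inj₁ x≈0) = 0≈⇒nonneg x≈0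
binary⇒nonneg (inj₂ x≈1) = NonNeg-resp (≈-sym x≈1) (pos⇒nonneg 1-pos)

nonneg-∑ : ∀ {n} (v : Vector ℝ n) → (∀ i → NonNeg (v i)) → NonNeg (∑ n v)
nonneg-∑ {zero}  v 0≤v = 0≈⇒nonneg ≈-refl
nonneg-∑ {suc n} v 0≤v = nonneg+nonneg (0≤v zero) (nonneg-∑ (v ∘ suc) (0≤v ∘ suc))

zero-∑ : ∀ {n} (v : Vector ℝ n) → (∀ i → v i ≈ 0ℝ) → ∑ n v ≈ 0ℝ
zero-∑ {n} v v≈0 = ≈-trans (Sum.sum-cong-≋ v≈0) (Sum.sum-replicate-zero n)

binary-search : ∀ {n} (v : Vector ℝ n) → (∀ i → Binary (v i)) →
  (∀ i → v i ≈ 0ℝ) ⊎ ∃[ i ] v i ≈ 1ℝ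
binary-search {zero}  v bin = inj₁ λ ()
binary-search {suc n} v bin with bin zero | binary-search (v ∘ suc) (bin ∘ suc)
... | inj₂ v₀≈1 | _                = inj₂ (zero , v₀≈1)
... | inj₁ _    | inj₂ (i , vᵢ≈1)  = inj₂ (suc i , vᵢ≈1)
... | inj₁ v₀≈0 | inj₁ v≈0         = inj₁ λ { zero → v₀≈0 ; (suc i) → v≈0 i }

binary-∑ : ∀ {n} (v : Vector ℝ n) → (∀ i → Binary (v i)) →
  ∑ n v ≈ 0ℝ ⊎ NonNeg (∑ n v - 1ℝ)
binary-∑ {n} v bin with binary-search v bin
... | inj₁ v≈0        = inj₁ (zero-∑ v v≈0)
... | inj₂ (i , vᵢ≈1) with n
...   | suc m = inj₂ (NonNeg-resp
          (≈-trans (≈-sym (pointwise λ k → solve 1 (λ s → con 1ℚ :+ s :- con 1ℚ := s) refl (seq rest k)))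
            (+-cong (≈-trans (+-cong (≈-sym vᵢ≈1) ≈-refl) (≈-sym (Sum.sum-remove {i = i} v))) ≈-refl))
          (nonneg-∑ (removeAt v i) (λ k → binary⇒nonneg (bin (punchIn i k)))))
  where rest = ∑ m (removeAt v i)

-- A positive entry plus the nonnegative sum of the others would be positive.
nonneg-∑≈0 : ∀ {n} (v : Vector ℝ n) → (∀ i → NonNeg (v i)) → ∑ n v ≈ 0ℝ → ∀ i → ¬ Pos (v i)
nonneg-∑≈0 {suc n} v 0≤v ∑v≈0 i 0<vᵢ = ¬neg (0≈⇒nonneg (≈-trans (-‿cong ∑v≈0) (pointwise λ _ → refl))) (Pos-resp
  (≈-trans (≈-sym (Sum.sum-remove {i = i} v)) (pointwise λ m →
    solve 1 (λ s → s := :- (:- s)) refl (seq (∑ (suc n) v) m)))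
  (pos+nonneg 0<vᵢ (nonneg-∑ (removeAt v i) (λ k → 0≤v (punchIn i k)))))

-- The complements `1ℝ - v k` are nonnegative and sum to 0, so none is positive; at an entry 0 the
-- complement would be 1.
binary-∑≈n⇒≈1 : ∀ {n} (v : Vector ℝ n) → (∀ i → Binary (v i)) →
  ∑ n v ≈ ∑[ _ < n ] 1ℝ → ∀ i → v i ≈ 1ℝ
binary-∑≈n⇒≈1 {n} v bin ∑v≈n i with bin i
... | inj₂ vᵢ≈1 = vᵢ≈1
... | inj₁ vᵢ≈0 = contradiction (Pos-resp (≈-sym (1-x≈1 vᵢ≈0)) 1-pos)
                    (nonneg-∑≈0 w (λ k → binary⇒nonneg (flip (bin k))) ∑w≈0 i)
  where
  w : Vector ℝ n
  w k = 1ℝ - v k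
  flip : ∀ {x} → Binary x → Binary (1ℝ - x)
  flip (inj₁ x≈0) = inj₂ (1-x≈1 x≈0)
  flip (inj₂ x≈1) = inj₁ (≈-trans (+-cong ≈-refl (-‿cong x≈1)) (pointwise λ _ → refl))
  ∑w≈0 : ∑ n w ≈ 0ℝ
  ∑w≈0 = begin
    ∑ n w                    ≈⟨ pointwise (λ m → solve 2 (λ w v → w := w :+ v :- v) refl
                                  (seq (∑ n w) m) (seq (∑ n v) m)) ⟩
    ∑ n w + ∑ n v - ∑ n v    ≈⟨ +-cong (Sum.∑-distrib-+ w v) ≈-refl ⟨
    (∑[ k < n ] (w k + v k)) - ∑ n v
      ≈⟨ +-cong (Sum.sum-cong-≋ λ k → pointwise λ m →
           solve 1 (λ x → con 1ℚ :- x :+ x := con 1ℚ) refl (seq (v k) m)) (-‿cong ∑v≈n) ⟩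
    (∑[ _ < n ] 1ℝ) - (∑[ _ < n ] 1ℝ)
      ≈⟨ pointwise (λ m → ℚ.+-inverseʳ (seq (∑[ _ < n ] 1ℝ) m)) ⟩
    0ℝ ∎
    where open SetoidReasoning ≈-setoid

-- Small rational steps

0<⊓ : ∀ {p q} → 0ℚ ℚ.< p → 0ℚ ℚ.< q → 0ℚ ℚ.< p ℚ.⊓ q
0<⊓ {p} {q} 0<p 0<q with ℚ.⊓-sel p q
... | inj₁ eq = ≡.subst (0ℚ ℚ.<_) (≡.sym eq) 0<p
... | inj₂ eq = ≡.subst (0ℚ ℚ.<_) (≡.sym eq) 0<q

fromℚ-pos : ∀ {q} → 0ℚ ℚ.< q → Pos (fromℚ q)
fromℚ-pos 0<q = let (_ , 0<p , p<q) = ℚ.<-dense 0<q in pos-pointwise 0<p (0 , λ _ _ → p<q)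

-- Half of a rational lower bound of `x` may be used up by `r`; the other half keeps the difference
-- positive.
pos-room : ∀ {x} → Pos x → Σ[ q ∈ ℚ ] 0ℚ ℚ.< q × (∀ r → r ℚ.≤ q → Pos (x - fromℚ r))
pos-room {x} 0<x = let (q , 0<q , q<x) = pos-bound 0<x in
  q ℚ.* ½ , 0<½* 0<q , λ r r≤½q → pos-pointwise (0<½* 0<q)
    (ev-map (λ n q<x → <-rearrange (ℚ.+-mono-<-≤ q<x r≤½q)
      (solve 3 (λ x q r → (x :+ q :* con ½) :- (q :+ r) := x :- r :- q :* con ½)
        refl (seq x n) q r)) q<x)


-- Steps from a local minimizer

p≤q⇒0≤q-p : ∀ {p q} → p ℚ.≤ q → 0ℚ ℚ.≤ q ℚ.- p
p≤q⇒0≤q-p {p} {q} p≤q =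
  ≡.subst (ℚ._≤ q ℚ.- p) (ℚ.+-inverseʳ p) (ℚ.+-monoˡ-≤ (ℚ.- p) p≤q)

-- For a single entry this joins membership in the unit interval with the sup-norm neighbourhood, so
-- that a step need only be checked at the entries it moves.
record Within (δ x v : ℝ) : Set where
  constructor within
  field
    lower : NonNeg v
    upper : NonNeg (1ℝ - v)
    near  : Pos (δ - ∣ v - x ∣)

within-resp : ∀ {δ x v w} → (∀ n → seq v n ≡ seq w n) → Within δ x v → Within δ x w
within-resp {δ} {x} eq (within l u d) = within
  (NonNeg-resp (pointwise eq) l)
  (NonNeg-resp (+-cong ≈-refl (-‿cong (pointwise eq))) u)
  (Pos-resp (pointwise λ n →
    ≡.cong (λ v → seq δ n ℚ.- ((v ℚ.- seq x n) ℚ.⊔ ℚ.- (v ℚ.- seq x n))) (eq n)) d)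

∣∣-near : ∀ {δ} x t r → Pos (δ - fromℚ r) →
  (∀ n → seq t n ℚ.≤ r) → (∀ n → ℚ.- seq t n ℚ.≤ r) → Pos (δ - ∣ x + t - x ∣)
∣∣-near {δ} x t r 0<δ-r t≤r -t≤r = Pos-resp
  (pointwise λ n → solve 3 (λ δ r a → (δ :- r) :+ (r :- a) := δ :- a) refl
    (seq δ n) r (seq ∣ x + t - x ∣ n))
  (pos+nonneg {y = fromℚ r - ∣ x + t - x ∣} 0<δ-r (nonneg-pointwise (0 , λ n _ → p≤q⇒0≤q-p (ℚ.⊔-lub
    (≡.subst (ℚ._≤ r)
      (solve 2 (λ x t → t := x :+ t :- x) refl (seq x n) (seq t n)) (t≤r n))
    (≡.subst (ℚ._≤ r)
      (solve 2 (λ x t → :- t := :- (x :+ t :- x)) refl (seq x n) (seq t n)) (-t≤r n))))))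

module _ {δ x : ℝ} (0<δ : Pos δ) (0≤x : NonNeg x) (x≤1 : NonNeg (1ℝ - x)) where

  within-self : Within δ x x
  within-self = within 0≤x x≤1 (Pos-resp (pointwise λ n → ≡.sym (≡.trans
    (≡.cong (λ d → seq δ n ℚ.- (d ℚ.⊔ ℚ.- d)) (ℚ.+-inverseʳ (seq x n)))
    (ℚ.+-identityʳ (seq δ n)))) 0<δ)

  -- Of the two caps on the step, `p` keeps the entry nonnegative and `q` keeps it within distance
  -- `δ`.
  within-down : Pos x → Σ[ q ∈ ℚ ] 0ℚ ℚ.< q ×
    (∀ r → 0ℚ ℚ.< r → r ℚ.≤ q → Within δ x (x - fromℚ r))
  within-down 0<x =
    let (p , 0<p , p-room) = pos-room 0<x
        (q , 0<q , q-room) = pos-room 0<δ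
    in p ℚ.⊓ q , 0<⊓ 0<p 0<q , λ r 0<r r≤p⊓q → within
      (pos⇒nonneg (p-room r (ℚ.≤-trans r≤p⊓q (ℚ.p⊓q≤p p q))))
      (NonNeg-resp (pointwise λ n →
          solve 2 (λ x r → (con 1ℚ :- x) :+ r := con 1ℚ :- (x :- r)) refl (seq x n) r)
        (nonneg+nonneg x≤1 (pos⇒nonneg (fromℚ-pos 0<r))))
      (∣∣-near x (- fromℚ r) r (q-room r (ℚ.≤-trans r≤p⊓q (ℚ.p⊓q≤q p q)))
        (λ _ → ℚ.≤-trans (ℚ.neg-antimono-≤ (ℚ.<⇒≤ 0<r)) (ℚ.<⇒≤ 0<r))
        (λ _ → ℚ.≤-reflexive (solve 1 (λ r → :- (:- r) := r) refl r)))

  within-up : Pos (1ℝ - x) → Σ[ q ∈ ℚ ] 0ℚ ℚ.< q ×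
    (∀ r → 0ℚ ℚ.< r → r ℚ.≤ q → Within δ x (x + fromℚ r))
  within-up x<1 =
    let (p , 0<p , p-room) = pos-room x<1
        (q , 0<q , q-room) = pos-room 0<δ
    in p ℚ.⊓ q , 0<⊓ 0<p 0<q , λ r 0<r r≤p⊓q → within
      (nonneg+nonneg 0≤x (pos⇒nonneg (fromℚ-pos 0<r)))
      (NonNeg-resp (pointwise λ n →
          solve 2 (λ x r → (con 1ℚ :- x) :- r := con 1ℚ :- (x :+ r)) refl (seq x n) r)
        (pos⇒nonneg (p-room r (ℚ.≤-trans r≤p⊓q (ℚ.p⊓q≤p p q)))))
      (∣∣-near x (fromℚ r) r (q-room r (ℚ.≤-trans r≤p⊓q (ℚ.p⊓q≤q p q)))
        (λ _ → ℚ.≤-refl)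
        (λ _ → ℚ.≤-trans (ℚ.neg-antimono-≤ (ℚ.<⇒≤ 0<r)) (ℚ.<⇒≤ 0<r)))

  within-both : Pos x → Pos (1ℝ - x) → Σ[ q ∈ ℚ ] 0ℚ ℚ.< q ×
    (∀ r → 0ℚ ℚ.< r → r ℚ.≤ q → Within δ x (x + fromℚ r) × Within δ x (x - fromℚ r))
  within-both 0<x x<1 =
    let (p , 0<p , up)   = within-up x<1
        (q , 0<q , down) = within-down 0<x
    in p ℚ.⊓ q , 0<⊓ 0<p 0<q , λ r 0<r r≤p⊓q →
      up r 0<r (ℚ.≤-trans r≤p⊓q (ℚ.p⊓q≤p p q)) ,
      down r 0<r (ℚ.≤-trans r≤p⊓q (ℚ.p⊓q≤q p q))

-- Interior entries and mixed second differences

Interior : ℝ → Set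
Interior x = Pos x × Pos (1ℝ - x)

-- `<1-or-0<` decides which end of the interval can be reached. Away from one end, not being
-- interior rules out being away from the other, and `nonneg-antisym` turns this into equality.
¬interior⇒binary : ∀ {x} → NonNeg x → NonNeg (1ℝ - x) → ¬ Interior x → Binary x
¬interior⇒binary {x} 0≤x x≤1 ¬int with <1-or-0< x
... | inj₁ x<1 = inj₁ (nonneg-antisym 0≤x (¬pos⇒nonneg- λ 0<x → ¬int (0<x , x<1)))
... | inj₂ 0<x = inj₂ (begin
  x              ≈⟨ pointwise (λ n → solve 1 (λ x → x := con 1ℚ :- (con 1ℚ :- x)) refl (seq x n)) ⟩
  1ℝ - (1ℝ - x)  ≈⟨ 1-x≈1 (nonneg-antisym x≤1 (¬pos⇒nonneg- λ x<1 → ¬int (0<x , x<1))) ⟩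
  1ℝ             ∎)
  where open SetoidReasoning ≈-setoid

module _ {n : ℕ} (c : Matrix n) (ε γ : ℝ) (x : Matrix n) where

  open Objective c ε γ

  -- The step raises the sum of row `i` by `t` and leaves column `l` alone, so the mixed second
  -- derivative of two entries in a row is 2γ.
  slope-bump-row : ∀ i j t {l} → l ≢ j →
    slope (bump x i j t) i l ≈ slope x i l + 2ℝ * γ * t
  slope-bump-row i j t {l} l≢j = ≈-trans
    (+-cong ≈-refl (*-congˡ (2ℝ * γ) (+-cong (+-cong
      (+-cong (+-cong (rowSum-bump-at x i j t) ≈-refl) (+-cong (colSum-bump-off x i j t l≢j) ≈-refl))
      (-‿cong (*-congˡ 2ℝ (≡⇒≈ (bump-off-col x i t i l≢j))))) ≈-refl)))
    (pointwise λ m → solve 6 (λ c g r k x t → let two = con (1ℚ ℚ.+ 1ℚ) in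
        c :+ two :* g :* ((r :+ t :- con 1ℚ) :+ (k :- con 1ℚ) :- two :* x :+ con 1ℚ) :=
        c :+ two :* g :* ((r :- con 1ℚ) :+ (k :- con 1ℚ) :- two :* x :+ con 1ℚ) :+ two :* g :* t)
      refl (seq (c i l + ε) m) (seq γ m) (seq (rowSum x i) m) (seq (colSum x l) m)
      (seq (x i l) m) (seq t m))

  slope-bump-col : ∀ i j t {k} → k ≢ i →
    slope (bump x i j t) k j ≈ slope x k j + 2ℝ * γ * t
  slope-bump-col i j t {k} k≢i = ≈-trans
    (+-cong ≈-refl (*-congˡ (2ℝ * γ) (+-cong (+-cong
      (+-cong (+-cong (rowSum-bump-off x i j t k≢i) ≈-refl) (+-cong (colSum-bump-at x i j t) ≈-refl))
      (-‿cong (*-congˡ 2ℝ (≡⇒≈ (≡.cong (λ row → row j) (bump-off-row x j t k≢i)))))) ≈-refl)))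
    (pointwise λ m → solve 6 (λ c g r k x t → let two = con (1ℚ ℚ.+ 1ℚ) in
        c :+ two :* g :* ((r :- con 1ℚ) :+ (k :+ t :- con 1ℚ) :- two :* x :+ con 1ℚ) :=
        c :+ two :* g :* ((r :- con 1ℚ) :+ (k :- con 1ℚ) :- two :* x :+ con 1ℚ) :+ two :* g :* t)
      refl (seq (c k j + ε) m) (seq γ m) (seq (rowSum x k) m) (seq (colSum x j) m)
      (seq (x k j) m) (seq t m))

  -- First- and second-order conditions

  module LocalMinimum (0<γ : Pos γ)
    (0≤x : ∀ i j → NonNeg (x i j)) (x≤1 : ∀ i j → NonNeg (1ℝ - x i j))
    {δ : ℝ} (0<δ : Pos δ)
    (minimal : ∀ y → (∀ i j → Within δ (x i j) (y i j)) → NonNeg (f̂deg c ε γ y - f̂deg c ε γ x))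
    where

    private
      f = f̂deg c ε γ

    bump-within : ∀ {i j t} → Within δ (x i j) (x i j + t) →
      ∀ k l → Within δ (x k l) (bump x i j t k l)
    bump-within {i} {j} {t} w = bump-elim (λ k l → Within δ (x k l)) x i j t
      (λ k l → within-self 0<δ (0≤x k l) (x≤1 k l)) w

    -- By `f̂deg-bump` the change of the objective is exactly `t * slope x i j`, with no remainder.
    first-order : ∀ {i j t} → Within δ (x i j) (x i j + t) → NonNeg (t * slope x i j)
    first-order {i} {j} {t} w = NonNeg-resp
      (≈-trans (+-cong (f̂deg-bump x i j t) ≈-refl) (pointwise λ m →
        solve 2 (λ a b → a :+ b :- a := b) refl (seq (f x) m) (seq (t * slope x i j) m)))
      (minimal (bump x i j t) (bump-within w))

    slope-nonpos : ∀ {i j} → Pos (x i j) → ¬ Pos (slope x i j)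
    slope-nonpos {i} {j} 0<x 0<slope =
      let (q , 0<q , down) = within-down 0<δ (0≤x i j) (x≤1 i j) 0<x in
      ¬neg (first-order {t = - fromℚ q} (down q 0<q ℚ.≤-refl)) (Pos-resp
        (pointwise λ m → solve 2 (λ q s → q :* s := :- ((:- q) :* s)) refl q (seq (slope x i j) m))
        (pos*pos (fromℚ-pos 0<q) 0<slope))

    slope-nonneg : ∀ {i j} → Pos (1ℝ - x i j) → ¬ Pos (- slope x i j)
    slope-nonneg {i} {j} x<1 slope<0 =
      let (q , 0<q , up) = within-up 0<δ (0≤x i j) (x≤1 i j) x<1 in
      ¬neg (first-order {t = fromℚ q} (up q 0<q ℚ.≤-refl)) (Pos-resp
        (pointwise λ m → solve 2 (λ q s → q :* (:- s) := :- (q :* s)) refl q (seq (slope x i j) m))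
        (pos*pos (fromℚ-pos 0<q) slope<0))

    -- The two hypotheses hold for distinct entries of a common row and for distinct entries of a
    -- common column, so both cases share one argument.
    module _ {i j k l} (off : ∀ t → bump x i j t k l ≡ x k l)
      (slope-eq : ∀ t → slope (bump x i j t) k l ≈ slope x k l + 2ℝ * γ * t) where

      -- The move along eᵢⱼ - eₖₗ is made of two single-entry steps; the slope for the second one is
      -- taken after the first.
      second-order : ∀ {t} → Within δ (x i j) (x i j + t) → Within δ (x k l) (x k l - t) →
        NonNeg (t * slope x i j + (- t) * (slope x k l + 2ℝ * γ * t))
      second-order {t} w₁ w₂ = NonNeg-resp
        (≈-trans
          (+-cong (≈-trans (f̂deg-bump y k l (- t))
            (+-cong (f̂deg-bump x i j t) (*-congˡ (- t) (slope-eq t)))) ≈-refl)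
          (pointwise λ m → solve 3 (λ a b c → a :+ b :+ c :- a := b :+ c) refl
            (seq (f x) m) (seq (t * slope x i j) m)
            (seq ((- t) * (slope x k l + 2ℝ * γ * t)) m)))
        (minimal (bump y k l (- t)) (bump-elim (λ k l → Within δ (x k l)) y k l (- t)
          (bump-within w₁) (≡.subst (λ v → Within δ (x k l) (v - t)) (≡.sym (off t)) w₂)))
        where y = bump x i j t

      -- Interior entries allow the move in both directions. Adding the conditions for `t` and `- t`
      -- cancels the slopes and leaves -4γt², which is negative.
      ¬both-interior : Interior (x i j) → ¬ Interior (x k l)
      ¬both-interior (0<a , a<1) (0<b , b<1) =
        let (p , 0<p , room-a) = within-both 0<δ (0≤x i j) (x≤1 i j) 0<a a<1
            (q , 0<q , room-b) = within-both 0<δ (0≤x k l) (x≤1 k l) 0<b b<1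
            r                  = p ℚ.⊓ q
            0<r                = 0<⊓ 0<p 0<q
            t                  = fromℚ r
            (a-up , a-down)    = room-a r 0<r (ℚ.p⊓q≤p p q)
            (b-up , b-down)    = room-b r 0<r (ℚ.p⊓q≤q p q)
            -- At `- t`, `second-order` expects the upward step written as subtraction of a
            -- negative.
            b-up′              = within-resp (λ m →
              solve 2 (λ x r → x :+ r := x :- (:- r)) refl (seq (x k l) m) r) b-up
            0<γt²              = pos*pos 0<γ (pos*pos (fromℚ-pos 0<r) (fromℚ-pos 0<r))
            0<2γt²             = pos+nonneg 0<γt² (pos⇒nonneg 0<γt²)
        in ¬neg (nonneg+nonneg (second-order {t} a-up b-down) (second-order { - t} a-down b-up′))
             (Pos-resp (pointwise λ m → solve 4
                 (λ a b g r → let two = con (1ℚ ℚ.+ 1ℚ) ; s = g :* (r :* r) :+ g :* (r :* r) in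
                   s :+ s := :- ((r :* a :+ (:- r) :* (b :+ two :* g :* r)) :+
                     ((:- r) :* a :+ (:- (:- r)) :* (b :+ two :* g :* (:- r)))))
                 refl (seq (slope x i j) m) (seq (slope x k l) m) (seq γ m) r)
               (pos+nonneg 0<2γt² (pos⇒nonneg 0<2γt²)))

-- Local minimizers are permutation matrices

module Assignment {m : ℕ} (c : Matrix (suc m)) (ε γ : ℝ) (x : Matrix (suc m))
  (0<ε : Pos ε) (0≤c : ∀ i j → NonNeg (c i j)) (c+ε<γ : ∀ i j → Pos (γ - (c i j + ε)))
  (0≤x : ∀ i j → NonNeg (x i j)) (x≤1 : ∀ i j → NonNeg (1ℝ - x i j))
  {δ : ℝ} (0<δ : Pos δ)
  (minimal : ∀ y → (∀ i j → Within δ (x i j) (y i j)) → NonNeg (f̂deg c ε γ y - f̂deg c ε γ x))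
  where

  0<ε+c : ∀ i j → Pos (ε + c i j)
  0<ε+c i j = pos+nonneg 0<ε (0≤c i j)

  0<γ : Pos γ
  0<γ = Pos-resp
    (pointwise λ k → solve 3 (λ g c e → g :- (c :+ e) :+ (e :+ c) := g) refl
      (seq γ k) (seq (c zero zero) k) (seq ε k))
    (pos+nonneg (c+ε<γ zero zero) (pos⇒nonneg (0<ε+c zero zero)))

  open Objective c ε γ
  open LocalMinimum c ε γ x 0<γ 0≤x x≤1 0<δ minimal

  -- Signs of the slopes

  rowRest colRest : Fin (suc m) → Fin (suc m) → ℝ
  rowRest i j = ∑ m (removeAt (x i) j)
  colRest i j = ∑ m (removeAt (λ k → x k j) i)

  rowSum-rest : ∀ i j → rowSum x i ≈ x i j + rowRest i j
  rowSum-rest i j = Sum.sum-remove {i = j} (x i)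

  colSum-rest : ∀ i j → colSum x j ≈ x i j + colRest i j
  colSum-rest i j = Sum.sum-remove {i = i} (λ k → x k j)

  -- The entry occurs once in its row sum and once in its column sum, which cancels the term -2xᵢⱼ.
  slope-rest : ∀ i j → slope x i j ≈ c i j + ε + 2ℝ * γ * (rowRest i j + colRest i j - 1ℝ)
  slope-rest i j = ≈-trans
    (+-cong ≈-refl (*-congˡ (2ℝ * γ) (+-cong (+-cong
      (+-cong (+-cong (rowSum-rest i j) ≈-refl) (+-cong (colSum-rest i j) ≈-refl)) ≈-refl) ≈-refl)))
    (pointwise λ k → solve 5 (λ c g x a b → let two = con (1ℚ ℚ.+ 1ℚ) in
        c :+ two :* g :* ((x :+ a :- con 1ℚ) :+ (x :+ b :- con 1ℚ) :- two :* x :+ con 1ℚ) :=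
        c :+ two :* g :* (a :+ b :- con 1ℚ))
      refl (seq (c i j + ε) k) (seq γ k) (seq (x i j) k)
      (seq (rowRest i j) k) (seq (colRest i j) k))

  rest≥1⇒slope>0 : ∀ i j → NonNeg (rowRest i j + colRest i j - 1ℝ) → Pos (slope x i j)
  rest≥1⇒slope>0 i j 1≤rest = Pos-resp
    (≈-trans
      (pointwise λ k → solve 4 (λ c e g t → let two = con (1ℚ ℚ.+ 1ℚ) in
          e :+ c :+ (g :* t :+ g :* t) := c :+ e :+ two :* g :* t)
        refl (seq (c i j) k) (seq ε k) (seq γ k) (seq (rowRest i j + colRest i j - 1ℝ) k))
      (≈-sym (slope-rest i j)))
    (pos+nonneg (0<ε+c i j) (nonneg+nonneg γt≥0 γt≥0))
    where γt≥0 = pos*nonneg 0<γ 1≤rest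

  -- The slope is now c + ε - 2γ, and its negative is the sum of γ - (c + ε) and γ, both positive.
  rest≈0⇒slope<0 : ∀ i j → rowRest i j + colRest i j ≈ 0ℝ → Pos (- slope x i j)
  rest≈0⇒slope<0 i j rest≈0 = Pos-resp
    (≈-trans
      (pointwise λ k → solve 3 (λ c e g → let two = con (1ℚ ℚ.+ 1ℚ) in
          (g :- (c :+ e)) :+ g := :- (c :+ e :+ two :* g :* (con 0ℚ :- con 1ℚ)))
        refl (seq (c i j) k) (seq ε k) (seq γ k))
      (-‿cong (≈-sym (≈-trans (slope-rest i j)
        (+-cong ≈-refl (*-congˡ (2ℝ * γ) (+-cong rest≈0 ≈-refl)))))))
    (pos+nonneg (c+ε<γ i j) (pos⇒nonneg 0<γ))

  -- Only the other entries of the two lines are assumed binary: the results first exclude an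
  -- interior entry at `i`, `j` and are used again once every entry is known to be binary.
  module _ (i j : Fin (suc m))
    (row-bin : ∀ l → Binary (removeAt (x i) j l))
    (col-bin : ∀ k → Binary (removeAt (λ k → x k j) i k)) where

    private
      a = rowRest i j
      b = colRest i j

    rest-dichotomy : (a ≈ 0ℝ × b ≈ 0ℝ) ⊎ NonNeg (a + b - 1ℝ)
    rest-dichotomy with binary-∑ _ row-bin | binary-∑ _ col-bin
    ... | inj₁ a≈0 | inj₁ b≈0 = inj₁ (a≈0 , b≈0)
    ... | inj₂ 1≤a | _        = inj₂ (NonNeg-resp
            (pointwise λ k → solve 2 (λ a b → a :- con 1ℚ :+ b := a :+ b :- con 1ℚ) refl (seq a k) (seq b k))
            (nonneg+nonneg 1≤a (nonneg-∑ _ (λ k → binary⇒nonneg (col-bin k)))))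
    ... | _        | inj₂ 1≤b = inj₂ (NonNeg-resp
            (pointwise λ k → solve 2 (λ a b → a :+ (b :- con 1ℚ) := a :+ b :- con 1ℚ) refl (seq a k) (seq b k))
            (nonneg+nonneg (nonneg-∑ _ (λ l → binary⇒nonneg (row-bin l))) 1≤b))

    pos⇒rest≈0 : Pos (x i j) → a ≈ 0ℝ × b ≈ 0ℝ
    pos⇒rest≈0 0<x with rest-dichotomy
    ... | inj₁ rest≈0 = rest≈0
    ... | inj₂ 1≤rest = contradiction (rest≥1⇒slope>0 i j 1≤rest) (slope-nonpos 0<x)

    <1⇒rest≉0 : Pos (1ℝ - x i j) → ¬ (a ≈ 0ℝ × b ≈ 0ℝ)
    <1⇒rest≉0 x<1 (a≈0 , b≈0) = slope-nonneg x<1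
      (rest≈0⇒slope<0 i j (≈-trans (+-cong a≈0 b≈0) (+-identityˡ 0ℝ)))

  -- An interior entry forces all others in its row and column to be binary. Being positive, it then
  -- needs both rests to vanish; being below 1, it forbids this.
  ¬interior : ∀ i j → ¬ Interior (x i j)
  ¬interior i j int@(0<x , x<1) =
    <1⇒rest≉0 i j row-bin col-bin x<1 (pos⇒rest≈0 i j row-bin col-bin 0<x)
    where
    row-bin : ∀ l → Binary (removeAt (x i) j l)
    row-bin l = let l≢j = Fin.punchInᵢ≢i j l in
      ¬interior⇒binary (0≤x i _) (x≤1 i _)
        (¬both-interior (λ t → bump-off-col x i t i l≢j) (λ t → slope-bump-row c ε γ x i j t l≢j) int)
    col-bin : ∀ k → Binary (removeAt (λ k → x k j) i k)
    col-bin k = let k≢i = Fin.punchInᵢ≢i i k in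
      ¬interior⇒binary (0≤x _ j) (x≤1 _ j)
        (¬both-interior (λ t → ≡.cong (λ row → row j) (bump-off-row x j t k≢i))
          (λ t → slope-bump-col c ε γ x i j t k≢i) int)

  binary : ∀ i j → Binary (x i j)
  binary i j = ¬interior⇒binary (0≤x i j) (x≤1 i j) (¬interior i j)

  -- Row and column sums

  one⇒sums≈1 : ∀ {i j} → x i j ≈ 1ℝ → rowSum x i ≈ 1ℝ × colSum x j ≈ 1ℝ
  one⇒sums≈1 {i} {j} x≈1 =
    -- An entry 1 is positive, so the rest of its row and of its column vanishes.
    let (a≈0 , b≈0) = pos⇒rest≈0 i j (λ l → binary i (punchIn j l)) (λ k → binary (punchIn i k) j)
                        (Pos-resp (≈-sym x≈1) 1-pos)
    in ≈-trans (rowSum-rest i j) (≈-trans (+-cong x≈1 a≈0) (+-identityʳ 1ℝ)) ,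
       ≈-trans (colSum-rest i j) (≈-trans (+-cong x≈1 b≈0) (+-identityʳ 1ℝ))

  row-search : ∀ i → (∀ j → x i j ≈ 0ℝ) ⊎ rowSum x i ≈ 1ℝ
  row-search i with binary-search (x i) (binary i)
  ... | inj₁ empty     = inj₁ empty
  ... | inj₂ (_ , x≈1) = inj₂ (proj₁ (one⇒sums≈1 x≈1))

  col-search : ∀ j → (∀ i → x i j ≈ 0ℝ) ⊎ colSum x j ≈ 1ℝ
  col-search j with binary-search (λ i → x i j) (λ i → binary i j)
  ... | inj₁ empty     = inj₁ empty
  ... | inj₂ (_ , x≈1) = inj₂ (proj₂ (one⇒sums≈1 x≈1))

  rowSum-binary : ∀ i → Binary (rowSum x i)
  rowSum-binary i with row-search i
  ... | inj₁ empty = inj₁ (zero-∑ (x i) empty)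
  ... | inj₂ sum≈1 = inj₂ sum≈1

  colSum-binary : ∀ j → Binary (colSum x j)
  colSum-binary j with col-search j
  ... | inj₁ empty = inj₁ (zero-∑ (λ i → x i j) empty)
  ... | inj₂ sum≈1 = inj₂ sum≈1

  -- An empty column would meet the empty row in an entry 0 whose rests both vanish; there the slope
  -- is negative and raising the entry would lower the objective.
  empty-row⇒colSum≈1 : ∀ {i} → (∀ j → x i j ≈ 0ℝ) → ∀ j → colSum x j ≈ 1ℝ
  empty-row⇒colSum≈1 {i} row-empty j with col-search j
  ... | inj₂ sum≈1     = sum≈1
  ... | inj₁ col-empty = contradiction
          (zero-∑ (removeAt (x i) j) (λ l → row-empty (punchIn j l)) ,
           zero-∑ (removeAt (λ k → x k j) i) (λ k → col-empty (punchIn i k)))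
          (<1⇒rest≉0 i j (λ l → binary i (punchIn j l)) (λ k → binary (punchIn i k) j)
            (Pos-resp (≈-sym (1-x≈1 (row-empty j))) 1-pos))

  rowSum≈1 : ∀ i → rowSum x i ≈ 1ℝ
  rowSum≈1 i with row-search i
  ... | inj₂ sum≈1 = sum≈1
  ... | inj₁ empty = binary-∑≈n⇒≈1 (rowSum x) rowSum-binary
          -- All column sums are 1, so exchanging the order of summation makes the row sums add up
          -- to the number of rows.
          (≈-trans (Sum.∑-comm x) (Sum.sum-cong-≋ (empty-row⇒colSum≈1 empty))) i

  colSum≈1 : ∀ j → colSum x j ≈ 1ℝ
  colSum≈1 = binary-∑≈n⇒≈1 (colSum x) colSum-binary
    (≈-trans (≈-sym (Sum.∑-comm x)) (Sum.sum-cong-≋ rowSum≈1))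

-- The maximal cost and the conclusion

≤-maximum : ∀ {n} .{{_ : ℕ.NonZero n}} (v : Vector ℝ n) i k → seq (v i) k ℚ.≤ seq (maximum v) k
≤-maximum {1}           v zero    k = ℚ.≤-refl
≤-maximum {suc (suc n)} v zero    k = ℚ.p≤p⊔q (seq (v zero) k) _
≤-maximum {suc (suc n)} v (suc i) k =
  ℚ.≤-trans (≤-maximum (v ∘ suc) i k) (ℚ.p≤q⊔p (seq (v zero) k) _)

cmax-bound : ∀ {n} .{{_ : ℕ.NonZero n}} (c : Matrix n) ε γ →
  cmax c ε < γ → ∀ i j → Pos (γ - (c i j + ε))
cmax-bound c ε γ cmax<γ i j = Pos-resp
  (pointwise λ k → solve 3 (λ γ M c → (γ :- M) :+ (M :- c) := γ :- c) refl
    (seq γ k) (seq (cmax c ε) k) (seq (c i j + ε) k))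
  (pos+nonneg {y = cmax c ε - (c i j + ε)} (<⇒Pos (cmax c ε) γ cmax<γ) (nonneg-pointwise (0 , λ k _ → p≤q⇒0≤q-p
    (ℚ.+-monoˡ-≤ (seq ε k) (ℚ.≤-trans (≤-maximum (c i) j k) (≤-maximum (λ i → maximum (c i)) i k))))))

theorem3p7 : (n : ℕ) (3≤n : 3 ℕ.≤ n)
    (c : Matrix n) → (∀ i → c i i ≃ 0ℝ) → (∀ i j → i ≢ j → 0ℝ ≤ c i j) →
    (ε : ℝ) → 0ℝ < ε →
    (γ : ℝ) → cmax {{3≤⇒nonZero 3≤n}} c ε < γ →
    (x : Matrix n) → IsLocalMinimizerOver InUnitBox (f̂deg c ε γ) x →
    (∀ i → rowSum x i ≃ 1ℝ) × (∀ j → colSum x j ≃ 1ℝ) × AssignmentFeasible x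
theorem3p7 (suc m) 3≤n c c-diag c-off ε 0<ε γ cmax<γ x (box , δ , 0<δ , minimal) =
  un≈ ∘ rowSum≈1 , un≈ ∘ colSum≈1 , record
    { rows = un≈ ∘ rowSum≈1 ; cols = un≈ ∘ colSum≈1
    ; binary = λ i j → ⊎.map un≈ un≈ (binary i j) }
  where
  0≤c : ∀ i j → NonNeg (c i j)
  0≤c i j with i Fin.≟ j
  ... | yes refl = 0≈⇒nonneg (mk≈ (c-diag i))
  ... | no i≢j   = 0≤⇒NonNeg (c-off i j i≢j)

  open Assignment c ε γ x (mkPos 0<ε) 0≤c
    (cmax-bound {{3≤⇒nonZero 3≤n}} c ε γ cmax<γ)
    (λ i j → 0≤⇒NonNeg (proj₁ (box i j)))
    (λ i j → ≤⇒NonNeg (x i j) 1ℝ (proj₂ (box i j)))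
    (mkPos {δ} 0<δ)
    -- `Within` at every entry is unpacked into membership in the box and closeness to `x`, as local
    -- minimality demands.
    (λ y w → ≤⇒NonNeg (f̂deg c ε γ x) (f̂deg c ε γ y) (minimal y
      (λ i j → NonNeg⇒≤ 0ℝ (y i j) (NonNeg-resp (≈-sym (x-0≈x (y i j))) (Within.lower (w i j))) ,
               NonNeg⇒≤ (y i j) 1ℝ (Within.upper (w i j)))
      (λ i j → Pos⇒< ∣ y i j - x i j ∣ δ (Within.near (w i j)))))
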